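{- Let $G$ be a connected graph of order $n$. For any two distinct vertices $u,v$ of $G$, order the vertices so that $u$ and $v$ come first and write $$L(G)+\frac1n\mathbb{J}=\begin{pmatrix} d_u+\frac1n & k & x^T\\ k & d_v+\frac1n & y^T\\ x & y & P\end{pmatrix},$$ where $k$ is a scalar, $x,y$ are column vectors and $P$ is a square matrix of order $n-2$ (all depending on $u,v$). Suppose that $P$ is invertible for each such pair. Then $G$ is resistance regular if and only if, for all distinct vertices $u,v$, $$d_v-d_u=y^TP^{ -1}y-x^TP^{ -1}x.$$
   Context: All graphs are finite, simple, undirected and connected. $d_i$ is the degree of vertex $i$; $L(G)=D-A$ is the Laplacian matrix ($D$ the diagonal degree matrix, $A$ the adjacency matrix); $\mathbb{J}$ is the $n\times n$ all-ones matrix. The resistance distance $r_{ij}$ is the effective resistance between vertices $i$ and $j$ when each edge of $G$ carries a unit resistance; equivalently (known fact) $r_{ij}=L_{ii}^++L_{jj}^+-2L_{ij}^+$, where $L^+$ is the Moore-Penrose inverse of $L(G)$. The resistance matrix is $R(G)=(r_{ij})$; $G$ is resistance regular if all row sums of $R(G)$ are equal. -}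

module Defs where

open import Algebra.Bundles using (CommutativeRing)
open import Data.Bool.Base using (if_then_else_)
open import Data.Fin.Base using (Fin; suc)
open import Data.Fin.Patterns using (0F; 1F)
open import Data.Fin.Permutation using (Permutation; _⟨$⟩ʳ_)
open import Data.Fin.Properties using (_≟_)
open import Data.Integer.Base using (+_)
open import Data.List.Base using (length; filter; allFin)
open import Data.Nat.Base as ℕ using (ℕ; NonZero; _∸_)
open import Data.Product.Base using (Σ-syntax; ∃-syntax; _×_)
open import Data.Rational.Base using (ℚ; 0ℚ; 1ℚ; _+_; _*_; _-_; _/_)
open import Data.Rational.Properties using (+-*-commutativeRing)
open import Data.Vec.Functional using (Vector)
open import Level using (0ℓ)
open import Relation.Binary.Construct.Closure.ReflexiveTransitive using (Star)
open import Relation.Binary.Core using (Rel)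
open import Relation.Binary.Definitions using (Decidable; Irreflexive; Symmetric)
open import Relation.Binary.PropositionalEquality.Core using (_≡_)
open import Relation.Nullary.Decidable.Core using (does)

open import Algebra.Properties.Semiring.Sum
  (CommutativeRing.semiring +-*-commutativeRing) using (sum; sum-syntax)

-- Rational scalars suffice: L(G) + J/n is a rational matrix, and a rational
-- matrix is invertible over ℝ exactly when it is invertible over ℚ (with the
-- same inverse); likewise a rational linear system has a real solution exactly
-- when it has a rational one, so effective resistances are rational.

Matrix : ℕ → ℕ → Set
Matrix m n = Fin m → Fin n → ℚ

private
  variable
    m n p : ℕ

infix  4 _≐_
infixl 7 _⊗_ _·_
infixr 8 _⊛_

_≐_ : Rel (Matrix m n) 0ℓ
A ≐ B = ∀ i j → A i j ≡ B i j

𝕀 : Matrix n n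
𝕀 i j = if does (i ≟ j) then 1ℚ else 0ℚ

𝕁 : Matrix n n
𝕁 _ _ = 1ℚ

_⊗_ : Matrix m n → Matrix n p → Matrix m p
_⊗_ {n = n} A B i j = ∑[ k < n ] (A i k * B k j)

_⊛_ : Matrix m n → Vector ℚ n → Vector ℚ m
_⊛_ {n = n} A x i = ∑[ k < n ] (A i k * x k)

-- x · y is xᵀ y for column vectors x and y.
_·_ : Vector ℚ n → Vector ℚ n → ℚ
_·_ {n} x y = ∑[ k < n ] (x k * y k)

record Invertible (A : Matrix n n) : Set where
  field
    inverse  : Matrix n n
    inverseˡ : inverse ⊗ A ≐ 𝕀
    inverseʳ : A ⊗ inverse ≐ 𝕀

open Invertible public using (inverse)

record Graph (n : ℕ) : Set₁ where
  infix 4 _~_ _~?_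
  field
    _~_    : Rel (Fin n) 0ℓ
    _~?_   : Decidable _~_
    sym    : Symmetric _~_
    irrefl : Irreflexive _≡_ _~_

module _ (G : Graph n) where
  open Graph G

  Connected : Set
  Connected = ∀ u v → Star _~_ u v

  degree : Fin n → ℕ
  degree i = length (filter (i ~?_) (allFin n))

  d : Fin n → ℚ
  d i = + degree i / 1

  adjacency : Matrix n n
  adjacency i j = if does (i ~? j) then 1ℚ else 0ℚ

  degreeMatrix : Matrix n n
  degreeMatrix i j = if does (i ≟ j) then d i else 0ℚ

  laplacian : Matrix n n
  laplacian i j = degreeMatrix i j - adjacency i j

  shiftedLaplacian : .{{NonZero n}} → Matrix n n
  shiftedLaplacian i j = laplacian i j + (+ 1 / n) * 𝕁 i j

  -- φ is the potential when a unit current enters at i and leaves at j: by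
  -- Ohm's law, the unit resistor on the edge pq carries current φ p - φ q from
  -- p to q, and by Kirchhoff's current law the net current flowing out of p
  -- into the network is the external current supplied at p.
  UnitCurrentPotential : Fin n → Fin n → Vector ℚ n → Set
  UnitCurrentPotential i j φ =
    ∀ p → ∑[ q < n ] (adjacency p q * (φ p - φ q)) ≡ 𝕀 i p - 𝕀 j p

  -- r is the effective resistance between i and j: the potential difference
  -- under a unit current.  For connected G there is exactly one such r,
  -- namely L⁺ᵢᵢ + L⁺ⱼⱼ - 2 L⁺ᵢⱼ.
  EffectiveResistance : Fin n → Fin n → ℚ → Set
  EffectiveResistance i j r =
    Σ[ φ ∈ Vector ℚ n ] (UnitCurrentPotential i j φ × r ≡ φ i - φ j)

  IsResistanceMatrix : Matrix n n → Set
  IsResistanceMatrix R = ∀ i j → EffectiveResistance i j (R i j)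

  ResistanceRegular : Set
  ResistanceRegular =
    ∃[ R ] (IsResistanceMatrix R × (∀ i j → sum (R i) ≡ sum (R j)))

-- Permutation (2 + (n ∸ 2)) n is inhabited only for n ≥ 2, so the truncated
-- subtraction is harmless.
record OrderingFrom (u v : Fin n) : Set where
  field
    perm   : Permutation (2 ℕ.+ (n ∸ 2)) n
    first  : perm ⟨$⟩ʳ 0F ≡ u
    second : perm ⟨$⟩ʳ 1F ≡ v

module Blocks .{{_ : NonZero n}} (G : Graph n)
              {u v : Fin n} (o : OrderingFrom u v) where
  open OrderingFrom o

  reordered : Matrix (2 ℕ.+ (n ∸ 2)) (2 ℕ.+ (n ∸ 2))
  reordered a b = shiftedLaplacian G (perm ⟨$⟩ʳ a) (perm ⟨$⟩ʳ b)

  x y : Vector ℚ (n ∸ 2)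
  x a = reordered (suc (suc a)) 0F
  y a = reordered (suc (suc a)) 1F

  P : Matrix (n ∸ 2) (n ∸ 2)
  P a b = reordered (suc (suc a)) (suc (suc b))

-- M = L + J/n has trivial kernel: M z = 0 forces ∑ z = 0, hence L z = 0, hence
-- zero Dirichlet energy, so z is constant along edges.  Block elimination with
-- P⁻¹ then solves M g_j = e_j, and the differences g_i - g_j are the unit
-- current potentials.  Since g has all row and column sums 1, the i-th row sum
-- of R is n g_ii + tr g - 2, so G is resistance regular iff g has constant
-- diagonal.  The block of g = M⁻¹ at u, v is the inverse of the 2 × 2 Schur
-- complement of P, whose diagonal entries are d_u + 1/n - xᵀ P⁻¹ x and
-- d_v + 1/n - yᵀ P⁻¹ y; a 2 × 2 matrix and its inverse have constant diagonal
-- simultaneously.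

module Submission where

open import Algebra.Bundles using (CommutativeRing)
open import Data.Bool.Base using (true; false; if_then_else_)
open import Data.Fin.Base using (Fin; zero; suc)
open import Data.Fin.Patterns using (0F; 1F)
open import Data.Fin.Permutation
  using (Permutation; _⟨$⟩ʳ_; _⟨$⟩ˡ_; inverseˡ; inverseʳ)
open import Data.Fin.Properties using (_≟_)
open import Data.Integer.Base as ℤ using () renaming (+_ to pos)
import Data.Integer.Properties as ℤ
open import Data.List.Base using (length; filter; tabulate)
open import Data.Nat.Base as ℕ using (ℕ; zero; suc; NonZero)
import Data.Nat.Coprimality as Coprime
open import Data.Product.Base using (Σ-syntax; _,_; _×_; proj₁; proj₂)
open import Data.Rational.Base as ℚ
  using (ℚ; mkℚ; 0ℚ; 1ℚ; _+_; _*_; _-_; -_; _/_; _≤_)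
open import Data.Rational.Properties as ℚ using (+-*-commutativeRing)
open import Data.Sum.Base using (inj₁; inj₂)
open import Data.Vec.Functional using (Vector; _∷_)
open import Defs
open import Function.Base using (_∘_; id)
open import Function.Bundles using (_⇔_; mk⇔; Equivalence)
open import Function.Construct.Composition using (_⇔-∘_)
open import Level using (0ℓ)
open import Relation.Binary.Construct.Closure.ReflexiveTransitive using (fold)
open import Relation.Binary.PropositionalEquality
open import Relation.Nullary using (does; yes; no; contradiction)
open import Relation.Nullary.Decidable
  using (dec-true; dec-false; dec⇒maybe; does-⇔)
open import Relation.Unary using (Pred; Decidable)
open import Tactic.RingSolver using (solve-∀)
open import Tactic.RingSolver.Core.AlmostCommutativeRing
  using (AlmostCommutativeRing; fromCommutativeRing)

open import Algebra.Properties.Group ℚ.+-0-group using (∙-cancelʳ)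
open import Algebra.Properties.Semiring.Sum
  (CommutativeRing.semiring +-*-commutativeRing)
open ≡-Reasoning

private
  variable
    m n k : ℕ

ring : AlmostCommutativeRing 0ℓ 0ℓ
ring = fromCommutativeRing +-*-commutativeRing (λ p → dec⇒maybe (0ℚ ℚ.≟ p))

-- Rational arithmetic

-- The fraction `pos k / 1` is normalised through a gcd, which is stuck for a variable `k`; the
-- `mkℚ` form exposes numerator and denominator to computation.
/1≡mkℚ : ∀ k → pos k / 1 ≡ mkℚ (pos k) 0 (Coprime.sym (Coprime.1-coprimeTo k))
/1≡mkℚ k = ℚ.normalize-coprime (Coprime.sym (Coprime.1-coprimeTo k))

suc/1 : ∀ k → pos (suc k) / 1 ≡ 1ℚ + pos k / 1
suc/1 k = sym (begin
  1ℚ + pos k / 1         ≡⟨ cong (λ q → 1ℚ + q) (/1≡mkℚ k) ⟩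
  (pos 1 ℤ.* pos 1 ℤ.+ pos k ℤ.* pos 1) / 1
    ≡⟨ ℚ./-cong (cong (λ z → pos 1 ℤ.+ z) (ℤ.*-identityʳ (pos k))) refl ⟩
  pos (suc k) / 1          ∎)

n/1*1/n : ∀ n .{{_ : NonZero n}} → (pos n / 1) * (pos 1 / n) ≡ 1ℚ
n/1*1/n (suc m) = begin
  (pos (suc m) / 1) * (pos 1 / suc m)
    ≡⟨ cong₂ _*_ (/1≡mkℚ (suc m)) (ℚ.normalize-coprime (Coprime.1-coprimeTo (suc m))) ⟩
  q * ℚ.1/ q ≡⟨ ℚ.*-inverseʳ q ⟩
  1ℚ ∎
  where q = mkℚ (pos (suc m)) 0 (Coprime.sym (Coprime.1-coprimeTo (suc m)))

-- The reciprocal is an explicit witness, so that both `ℚ.1/ p` and `pos 1 / n` can serve.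
*-cancelˡ-invertible : ∀ p′ p {q r} → p′ * p ≡ 1ℚ → p * q ≡ p * r → q ≡ r
*-cancelˡ-invertible p′ p {q} {r} p′p≡1 pq≡pr = begin
  q            ≡⟨ ℚ.*-identityˡ q ⟨
  1ℚ * q       ≡⟨ cong (_* q) p′p≡1 ⟨
  p′ * p * q   ≡⟨ ℚ.*-assoc p′ p q ⟩
  p′ * (p * q) ≡⟨ cong (p′ *_) pq≡pr ⟩
  p′ * (p * r) ≡⟨ ℚ.*-assoc p′ p r ⟨
  p′ * p * r   ≡⟨ cong (_* r) p′p≡1 ⟩
  1ℚ * r       ≡⟨ ℚ.*-identityˡ r ⟩
  r            ∎

x-y≡0⇒x≡y : ∀ p q → p - q ≡ 0ℚ → p ≡ q
x-y≡0⇒x≡y p q eq = begin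
  p         ≡⟨ lem p q ⟩
  p - q + q ≡⟨ cong (_+ q) eq ⟩
  0ℚ + q    ≡⟨ ℚ.+-identityˡ q ⟩
  q         ∎
  where
  lem : ∀ p q → p ≡ p - q + q
  lem = solve-∀ ring

p*p≥0 : ∀ p → 0ℚ ≤ p * p
p*p≥0 p with ℚ.≤-total 0ℚ p
... | inj₁ 0≤p = ℚ.nonNegative⁻¹ (p * p) {{ℚ.nonNeg*nonNeg⇒nonNeg p p}}
  where instance _ = ℚ.nonNegative 0≤p
... | inj₂ p≤0 = ℚ.nonNegative⁻¹ (p * p) {{ℚ.nonPos*nonPos⇒nonPos p p}}
  where instance _ = ℚ.nonPositive p≤0

p*p≡0⇒p≡0 : ∀ p → p * p ≡ 0ℚ → p ≡ 0ℚ
p*p≡0⇒p≡0 p p²≡0 with p ℚ.≟ 0ℚ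
... | yes p≡0 = p≡0
... | no p≢0 = *-cancelˡ-invertible (ℚ.1/ p) p (ℚ.*-inverseˡ p) (trans p²≡0 (sym (ℚ.*-zeroʳ p)))
  where instance _ = ℚ.≢-nonZero p≢0

p+q≡0⇒p≡0 : ∀ {p q} → 0ℚ ≤ p → 0ℚ ≤ q → p + q ≡ 0ℚ → p ≡ 0ℚ
p+q≡0⇒p≡0 {p} {q} 0≤p 0≤q p+q≡0 = ℚ.≤-antisym
  (subst₂ _≤_ (ℚ.+-identityʳ p) p+q≡0 (ℚ.+-monoʳ-≤ p 0≤q)) 0≤p

-- Finite sums

∑-distrib-- : ∀ {n} (f g : Vector ℚ n) → ∑[ i < n ] (f i - g i) ≡ sum f - sum g
∑-distrib-- {zero}  f g = refl
∑-distrib-- {suc n} f g = trans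
  (cong (λ s → f zero - g zero + s) (∑-distrib-- (f ∘ suc) (g ∘ suc)))
  (lem (f zero) (g zero) (sum (f ∘ suc)) (sum (g ∘ suc)))
  where
  lem : ∀ a b c d → a - b + (c - d) ≡ (a + c) - (b + d)
  lem = solve-∀ ring

∑-const : ∀ n c → ∑[ i < n ] c ≡ (pos n / 1) * c
∑-const zero    c = sym (ℚ.*-zeroˡ c)
∑-const (suc n) c = begin
  c + ∑[ i < n ] c     ≡⟨ cong (c +_) (∑-const n c) ⟩
  c + (pos n / 1) * c    ≡⟨ lem c (pos n / 1) ⟩
  (1ℚ + pos n / 1) * c   ≡⟨ cong (_* c) (suc/1 n) ⟨
  (pos (suc n) / 1) * c    ∎
  where
  lem : ∀ c p → c + p * c ≡ (1ℚ + p) * c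
  lem = solve-∀ ring

∑-zero : ∀ {f : Vector ℚ n} → (∀ i → f i ≡ 0ℚ) → sum f ≡ 0ℚ
∑-zero {n} f≡0 = trans (sum-cong-≗ f≡0) (sum-replicate-zero n)

∑-nonneg : ∀ {f : Vector ℚ n} → (∀ i → 0ℚ ≤ f i) → 0ℚ ≤ sum f
∑-nonneg {zero}  f≥0 = ℚ.≤-refl
∑-nonneg {suc n} f≥0 = ℚ.+-mono-≤ (f≥0 zero) (∑-nonneg (f≥0 ∘ suc))

∑≡0⇒≡0 : ∀ {f : Vector ℚ n} → (∀ i → 0ℚ ≤ f i) → sum f ≡ 0ℚ → ∀ i → f i ≡ 0ℚ
∑≡0⇒≡0 f≥0 ∑≡0 zero    = p+q≡0⇒p≡0 (f≥0 zero) (∑-nonneg (f≥0 ∘ suc)) ∑≡0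
∑≡0⇒≡0 {f = f} f≥0 ∑≡0 (suc i) = ∑≡0⇒≡0 (f≥0 ∘ suc)
  (p+q≡0⇒p≡0 (∑-nonneg (f≥0 ∘ suc)) (f≥0 zero)
    (trans (ℚ.+-comm (sum (f ∘ suc)) (f zero)) ∑≡0)) i

-- A general `f` lets the induction pass to `f ∘ suc`; with `f = id` the left side is a vertex
-- degree.
∑-indicator : ∀ {a p} {A : Set a} {P : Pred A p} (P? : Decidable P) (f : Fin n → A) →
  pos (length (filter P? (tabulate f))) / 1 ≡ ∑[ i < n ] (if does (P? (f i)) then 1ℚ else 0ℚ)
∑-indicator {zero}  P? f = refl
∑-indicator {suc n} P? f with does (P? (f zero))
... | true  = trans (suc/1 (length (filter P? (tabulate (f ∘ suc)))))
  (cong (1ℚ +_) (∑-indicator P? (f ∘ suc)))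
... | false = trans (∑-indicator P? (f ∘ suc)) (sym (ℚ.+-identityˡ _))

-- Matrix algebra

𝕀-diag : (i : Fin n) → 𝕀 i i ≡ 1ℚ
𝕀-diag i = cong (if_then 1ℚ else 0ℚ) (dec-true (i ≟ i) refl)

𝕀-off-diag : {i j : Fin n} → i ≢ j → 𝕀 i j ≡ 0ℚ
𝕀-off-diag {i = i} {j} i≢j = cong (if_then 1ℚ else 0ℚ) (dec-false (i ≟ j) i≢j)

𝕀-⊛ : (x : Vector ℚ n) → ∀ i → (𝕀 ⊛ x) i ≡ x i
𝕀-⊛ x zero = trans
  (cong₂ _+_ (ℚ.*-identityˡ (x zero)) (∑-zero (λ k → ℚ.*-zeroˡ (x (suc k)))))
  (ℚ.+-identityʳ (x zero))
𝕀-⊛ x (suc i) = trans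
  (cong₂ _+_ (ℚ.*-zeroˡ (x zero)) (𝕀-⊛ (x ∘ suc) i))
  (ℚ.+-identityˡ (x (suc i)))

𝕀-sym : (i j : Fin n) → 𝕀 i j ≡ 𝕀 j i
𝕀-sym zero    zero    = refl
𝕀-sym zero    (suc j) = refl
𝕀-sym (suc i) zero    = refl
𝕀-sym (suc i) (suc j) = 𝕀-sym i j

∑-𝕀 : (i : Fin n) → sum (𝕀 i) ≡ 1ℚ
∑-𝕀 i = trans (sum-cong-≗ (λ k → sym (ℚ.*-identityʳ (𝕀 i k)))) (𝕀-⊛ (λ _ → 1ℚ) i)

·-cong : {x x′ y y′ : Vector ℚ n} → x ≗ x′ → y ≗ y′ → x · y ≡ x′ · y′
·-cong x≗x′ y≗y′ = sum-cong-≗ (λ k → cong₂ _*_ (x≗x′ k) (y≗y′ k))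

⊛-cong : (A : Matrix m n) {x y : Vector ℚ n} → x ≗ y → ∀ i → (A ⊛ x) i ≡ (A ⊛ y) i
⊛-cong A x≗y i = ·-cong {x = A i} (λ _ → refl) x≗y

·-distrib-+ : (x y z : Vector ℚ n) → x · (λ i → y i + z i) ≡ x · y + x · z
·-distrib-+ x y z = trans (sum-cong-≗ (λ k → ℚ.*-distribˡ-+ (x k) (y k) (z k)))
  (∑-distrib-+ (λ k → x k * y k) (λ k → x k * z k))

·-distrib-- : (x y z : Vector ℚ n) → x · (λ i → y i - z i) ≡ x · y - x · z
·-distrib-- x y z = trans (sum-cong-≗ (λ k → lem (x k) (y k) (z k)))
  (∑-distrib-- (λ k → x k * y k) (λ k → x k * z k))
  where
  lem : ∀ a b c → a * (b - c) ≡ a * b - a * c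
  lem = solve-∀ ring

·-*ʳ : (x y : Vector ℚ n) (s : ℚ) → x · (λ i → y i * s) ≡ (x · y) * s
·-*ʳ x y s = trans (sum-cong-≗ (λ k → sym (ℚ.*-assoc (x k) (y k) s)))
  (sym (*-distribʳ-sum s (λ k → x k * y k)))

⊗-⊛ : (A : Matrix m n) (B : Matrix n k) (x : Vector ℚ k) →
  ∀ i → ((A ⊗ B) ⊛ x) i ≡ (A ⊛ (B ⊛ x)) i
⊗-⊛ {n = n} {k} A B x i = begin
  ∑[ c < k ] (∑[ b < n ] (A i b * B b c) * x c)
    ≡⟨ sum-cong-≗ (λ c → *-distribʳ-sum (x c) (λ b → A i b * B b c)) ⟩
  ∑[ c < k ] ∑[ b < n ] (A i b * B b c * x c)
    ≡⟨ ∑-comm (λ c b → A i b * B b c * x c) ⟩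
  ∑[ b < n ] ∑[ c < k ] (A i b * B b c * x c)
    ≡⟨ sum-cong-≗ (λ b → sum-cong-≗ (λ c → ℚ.*-assoc (A i b) (B b c) (x c))) ⟩
  ∑[ b < n ] ∑[ c < k ] (A i b * (B b c * x c))
    ≡⟨ sum-cong-≗ (λ b → sym (*-distribˡ-sum (A i b) (λ c → B b c * x c))) ⟩
  ∑[ b < n ] (A i b * ∑[ c < k ] (B b c * x c)) ∎

⊗-𝕀-⊛ : (A : Matrix m n) (B : Matrix n m) → A ⊗ B ≐ 𝕀 → (x : Vector ℚ m) →
  ∀ i → (A ⊛ (B ⊛ x)) i ≡ x i
⊗-𝕀-⊛ A B AB≐𝕀 x i = begin
  (A ⊛ (B ⊛ x)) i  ≡⟨ ⊗-⊛ A B x i ⟨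
  ((A ⊗ B) ⊛ x) i  ≡⟨ sum-cong-≗ (λ k → cong (_* x k) (AB≐𝕀 i k)) ⟩
  (𝕀 ⊛ x) i        ≡⟨ 𝕀-⊛ x i ⟩
  x i              ∎

-- The bracket is the shape of a right-hand side after two unknowns are moved across; `eliminate`
-- uses this once for the rows of `Q` and once for a row of `N`.
·-affine : (x b c e : Vector ℚ n) (s t : ℚ) →
  x · (λ i → b i - (c i * s + e i * t)) ≡ x · b - ((x · c) * s + (x · e) * t)
·-affine x b c e s t = begin
  x · (λ i → b i - (c i * s + e i * t))
    ≡⟨ ·-distrib-- x b (λ i → c i * s + e i * t) ⟩
  x · b - x · (λ i → c i * s + e i * t)
    ≡⟨ cong (λ p → x · b - p) (·-distrib-+ x (λ i → c i * s) (λ i → e i * t)) ⟩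
  x · b - (x · (λ i → c i * s) + x · (λ i → e i * t))
    ≡⟨ cong (λ p → x · b - p) (cong₂ _+_ (·-*ʳ x c s) (·-*ʳ x e t)) ⟩
  x · b - ((x · c) * s + (x · e) * t) ∎

-- Two-by-two systems

module _ (a b c d : ℚ) where

  private
    det : ℚ
    det = a * d - b * c

  -- If `det` vanishes, the adjugate columns `(d, - c)` and `(- b, a)` lie in the kernel, so `c` and
  -- `a` are zero. Then `(1, 0)` lies in the kernel as well, which is absurd.
  trivialKernel⇒det≢0 :
    (∀ s t → a * s + b * t ≡ 0ℚ → c * s + d * t ≡ 0ℚ → s ≡ 0ℚ × t ≡ 0ℚ) → det ≢ 0ℚ
  trivialKernel⇒det≢0 ker det≡0 =
    contradiction (proj₁ (ker 1ℚ 0ℚ (first a b a≡0) (first c d c≡0))) λ ()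
    where
    firstColumn : ∀ a b c d → a * d + b * - c ≡ a * d - b * c
    firstColumn = solve-∀ ring
    firstColumn₀ : ∀ c d → c * d + d * - c ≡ 0ℚ
    firstColumn₀ = solve-∀ ring
    secondColumn : ∀ a b c d → c * - b + d * a ≡ a * d - b * c
    secondColumn = solve-∀ ring
    secondColumn₀ : ∀ a b → a * - b + b * a ≡ 0ℚ
    secondColumn₀ = solve-∀ ring
    c≡0 : c ≡ 0ℚ
    c≡0 = ℚ.neg-injective {c} {0ℚ}
      (proj₂ (ker d (- c) (trans (firstColumn a b c d) det≡0) (firstColumn₀ c d)))
    a≡0 : a ≡ 0ℚ
    a≡0 = proj₂ (ker (- b) a (secondColumn₀ a b) (trans (secondColumn a b c d) det≡0))
    first : ∀ p q → p ≡ 0ℚ → p * 1ℚ + q * 0ℚ ≡ 0ℚ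
    first p q p≡0 = trans (cong₂ _+_ (ℚ.*-identityʳ p) (ℚ.*-zeroʳ q))
      (trans (ℚ.+-identityʳ p) p≡0)

  -- The witnesses are the adjugate applied to `(e, f)`, divided by `det`.
  cramer : det ≢ 0ℚ → ∀ e f →
    Σ[ s ∈ ℚ ] Σ[ t ∈ ℚ ] (a * s + b * t ≡ e × c * s + d * t ≡ f)
  cramer det≢0 e f = (d * e - b * f) * δ , (a * f - c * e) * δ ,
    trans (lem₁ a b c d e f δ) (scaled e) , trans (lem₂ a b c d e f δ) (scaled f)
    where
    instance _ = ℚ.≢-nonZero det≢0
    δ : ℚ
    δ = ℚ.1/ det
    lem₁ : ∀ a b c d e f δ →
      a * ((d * e - b * f) * δ) + b * ((a * f - c * e) * δ) ≡ (a * d - b * c) * δ * e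
    lem₁ = solve-∀ ring
    lem₂ : ∀ a b c d e f δ →
      c * ((d * e - b * f) * δ) + d * ((a * f - c * e) * δ) ≡ (a * d - b * c) * δ * f
    lem₂ = solve-∀ ring
    scaled : ∀ e → det * δ * e ≡ e
    scaled e = trans (cong (_* e) (ℚ.*-inverseʳ det)) (ℚ.*-identityˡ e)

  -- The inverse of ((a , b) , (c , d)) is its adjugate divided by det, so the
  -- diagonals of the two matrices are swapped up to a common factor.
  inverse-diagonal : ∀ p q r s →
    a * p + b * r ≡ 1ℚ → c * p + d * r ≡ 0ℚ →
    a * q + b * s ≡ 0ℚ → c * q + d * s ≡ 1ℚ →
    p ≡ s ⇔ a ≡ d
  inverse-diagonal p q r s eq₁₁ eq₂₁ eq₁₂ eq₂₂ = mk⇔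
    (λ p≡s → begin
      a         ≡⟨ combine a c eq₂₂ eq₁₂ ⟨
      a * (c * q + d * s) - c * (a * q + b * s) ≡⟨ lem₁ a b c d q s ⟨
      det * s   ≡⟨ cong (det *_) p≡s ⟨
      det * p   ≡⟨ lem₂ a b c d p r ⟩
      d * (a * p + b * r) - b * (c * p + d * r) ≡⟨ combine d b eq₁₁ eq₂₁ ⟩
      d         ∎)
    (λ a≡d → begin
      p         ≡⟨ combine p q eq₂₂ eq₂₁ ⟨
      p * (c * q + d * s) - q * (c * p + d * r) ≡⟨ lem₃ c d p q r s ⟨
      (p * s - q * r) * d ≡⟨ cong ((p * s - q * r) *_) a≡d ⟨
      (p * s - q * r) * a ≡⟨ lem₄ a b p q r s ⟩
      s * (a * p + b * r) - r * (a * q + b * s) ≡⟨ combine s r eq₁₁ eq₁₂ ⟩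
      s         ∎)
    where
    combine : ∀ x y {u v} → u ≡ 1ℚ → v ≡ 0ℚ → x * u - y * v ≡ x
    combine x y refl refl = trans (cong₂ _-_ (ℚ.*-identityʳ x) (ℚ.*-zeroʳ y)) (ℚ.+-identityʳ x)
    lem₁ : ∀ a b c d q s →
      (a * d - b * c) * s ≡ a * (c * q + d * s) - c * (a * q + b * s)
    lem₁ = solve-∀ ring
    lem₂ : ∀ a b c d p r →
      (a * d - b * c) * p ≡ d * (a * p + b * r) - b * (c * p + d * r)
    lem₂ = solve-∀ ring
    lem₃ : ∀ c d p q r s →
      (p * s - q * r) * d ≡ p * (c * q + d * s) - q * (c * p + d * r)
    lem₃ = solve-∀ ring
    lem₄ : ∀ a b p q r s →
      (p * s - q * r) * a ≡ s * (a * p + b * r) - r * (a * q + b * s)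
    lem₄ = solve-∀ ring

-- Schur complements

Injective : Matrix n n → Set
Injective A = ∀ x → (∀ i → (A ⊛ x) i ≡ 0ℚ) → ∀ i → x i ≡ 0ℚ

-- `Q` stands for the inverse of `trailing`. Being a left inverse makes the trailing coordinates of
-- a solution unique given the first two; being a right inverse makes them exist.
module Schur (N : Matrix (2 ℕ.+ m) (2 ℕ.+ m)) (Q : Matrix m m) where

  row column : Fin (2 ℕ.+ m) → Vector ℚ m
  row    i b = N i (suc (suc b))
  column j a = N (suc (suc a)) j

  trailing : Matrix m m
  trailing a b = N (suc (suc a)) (suc (suc b))

  -- Only the entries with i, j ∈ {0F, 1F} are meaningful.
  S : Matrix (2 ℕ.+ m) (2 ℕ.+ m)
  S i j = N i j - row i · (Q ⊛ column j)

  -- What remains on the right of the trailing equations once the first two unknowns have the values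
  -- `s` and `t`.
  residual : (b : Vector ℚ m) (s t : ℚ) → Vector ℚ m
  residual b s t a = b a - (column 0F a * s + column 1F a * t)

  -- Substituting the solved tail into row `i` turns the coefficients of the first two unknowns into
  -- entries of `S`, and `b` contributes the constant term.
  eliminate : ∀ z b → (∀ a → z (suc (suc a)) ≡ (Q ⊛ residual b (z 0F) (z 1F)) a) →
    ∀ i → (N ⊛ z) i ≡ (S i 0F * z 0F + S i 1F * z 1F) + row i · (Q ⊛ b)
  eliminate z b z≡ i = begin
    N i 0F * s + (N i 1F * t + row i · (λ a → z (suc (suc a))))
      ≡⟨ cong (λ p → N i 0F * s + (N i 1F * t + p)) tail≡ ⟩
    N i 0F * s + (N i 1F * t + (β - (β₀ * s + β₁ * t)))
      ≡⟨ lem (N i 0F) (N i 1F) s t β β₀ β₁ ⟩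
    (S i 0F * s + S i 1F * t) + β ∎
    where
    s t β β₀ β₁ : ℚ
    s = z 0F
    t = z 1F
    β = row i · (Q ⊛ b)
    β₀ = row i · (Q ⊛ column 0F)
    β₁ = row i · (Q ⊛ column 1F)
    tail≡ : row i · (λ a → z (suc (suc a))) ≡ β - (β₀ * s + β₁ * t)
    tail≡ = begin
      row i · (λ a → z (suc (suc a)))
        ≡⟨ ·-cong {x = row i} (λ _ → refl) z≡ ⟩
      row i · (Q ⊛ residual b s t)
        ≡⟨ ·-cong {x = row i} (λ _ → refl)
             (λ a → ·-affine (Q a) b (column 0F) (column 1F) s t) ⟩
      row i · (λ a → (Q ⊛ b) a - ((Q ⊛ column 0F) a * s + (Q ⊛ column 1F) a * t))
        ≡⟨ ·-affine (row i) (Q ⊛ b) (Q ⊛ column 0F) (Q ⊛ column 1F) s t ⟩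
      β - (β₀ * s + β₁ * t) ∎
    lem : ∀ n₀ n₁ s t β β₀ β₁ → n₀ * s + (n₁ * t + (β - (β₀ * s + β₁ * t))) ≡
      ((n₀ - β₀) * s + (n₁ - β₁) * t) + β
    lem = solve-∀ ring

  row-·-Q-0 : ∀ i → row i · (Q ⊛ (λ _ → 0ℚ)) ≡ 0ℚ
  row-·-Q-0 i = ∑-zero λ a → trans
    (cong (row i a *_) (∑-zero (λ c → ℚ.*-zeroʳ (Q a c)))) (ℚ.*-zeroʳ (row i a))

  eliminate₀ : ∀ z → (∀ a → z (suc (suc a)) ≡ (Q ⊛ residual (λ _ → 0ℚ) (z 0F) (z 1F)) a) →
    ∀ i → (N ⊛ z) i ≡ S i 0F * z 0F + S i 1F * z 1F
  eliminate₀ z z≡ i = begin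
    (N ⊛ z) i                                    ≡⟨ eliminate z (λ _ → 0ℚ) z≡ i ⟩
    Sz + row i · (Q ⊛ (λ _ → 0ℚ))                ≡⟨ cong (λ p → Sz + p) (row-·-Q-0 i) ⟩
    Sz + 0ℚ                                      ≡⟨ ℚ.+-identityʳ Sz ⟩
    Sz                                           ∎
    where
    Sz : ℚ
    Sz = S i 0F * z 0F + S i 1F * z 1F

  module _ (Q⊗P≐𝕀 : Q ⊗ trailing ≐ 𝕀) where

    -- Apply `Q` to the trailing equations with the first two unknowns moved to the right.
    back-substitute : ∀ z b → (∀ a → (N ⊛ z) (suc (suc a)) ≡ b a) →
      ∀ a → z (suc (suc a)) ≡ (Q ⊛ residual b (z 0F) (z 1F)) a
    back-substitute z b Nz≡b a = begin
      w a                                ≡⟨ ⊗-𝕀-⊛ Q trailing Q⊗P≐𝕀 w a ⟨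
      (Q ⊛ (trailing ⊛ w)) a             ≡⟨ ⊛-cong Q trailing-w a ⟩
      (Q ⊛ residual b (z 0F) (z 1F)) a   ∎
      where
      w : Vector ℚ m
      w a = z (suc (suc a))
      lem : ∀ c e r → r ≡ c + (e + r) - (c + e)
      lem = solve-∀ ring
      trailing-w : ∀ c → (trailing ⊛ w) c ≡ residual b (z 0F) (z 1F) c
      trailing-w c = trans
        (lem (column 0F c * z 0F) (column 1F c * z 1F) ((trailing ⊛ w) c))
        (cong (λ p → p - (column 0F c * z 0F + column 1F c * z 1F)) (Nz≡b c))

  module _ (P⊗Q≐𝕀 : trailing ⊗ Q ≐ 𝕀) where

    extend : (b : Vector ℚ m) (s t : ℚ) → Vector ℚ (2 ℕ.+ m)
    extend b s t = s ∷ t ∷ (Q ⊛ residual b s t)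

    extend-solves : ∀ b s t a → (N ⊛ extend b s t) (suc (suc a)) ≡ b a
    extend-solves b s t a = begin
      column 0F a * s + (column 1F a * t + (trailing ⊛ (Q ⊛ residual b s t)) a)
        ≡⟨ cong (λ p → column 0F a * s + (column 1F a * t + p))
             (⊗-𝕀-⊛ trailing Q P⊗Q≐𝕀 (residual b s t) a) ⟩
      column 0F a * s + (column 1F a * t + (b a - (column 0F a * s + column 1F a * t)))
        ≡⟨ lem (column 0F a * s) (column 1F a * t) (b a) ⟩
      b a ∎
      where
      lem : ∀ c e r → c + (e + (r - (c + e))) ≡ r
      lem = solve-∀ ring

    -- A kernel vector `(s, t)` of the Schur complement extends to a kernel vector of `N`, so it is
    -- zero and the determinant is nonzero. Cramer's rule then gives the first two coordinates, and
    -- `extend` the others.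
    solvable : Injective N → (b : Vector ℚ (2 ℕ.+ m)) →
      Σ[ z ∈ Vector ℚ (2 ℕ.+ m) ] (∀ i → (N ⊛ z) i ≡ b i)
    solvable injective b = extend b′ s t , Nz≡b
      where
      b′ : Vector ℚ m
      b′ a = b (suc (suc a))
      kernel : ∀ s t → S 0F 0F * s + S 0F 1F * t ≡ 0ℚ → S 1F 0F * s + S 1F 1F * t ≡ 0ℚ →
        s ≡ 0ℚ × t ≡ 0ℚ
      kernel s t S₀≡0 S₁≡0 = z≡0 0F , z≡0 1F
        where
        z : Vector ℚ (2 ℕ.+ m)
        z = extend (λ _ → 0ℚ) s t
        z≡0 : ∀ i → z i ≡ 0ℚ
        z≡0 = injective z λ where
          0F            → trans (eliminate₀ z (λ _ → refl) 0F) S₀≡0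
          1F            → trans (eliminate₀ z (λ _ → refl) 1F) S₁≡0
          (suc (suc a)) → extend-solves (λ _ → 0ℚ) s t a
      -- The constant term found in `eliminate` is moved to the right-hand side.
      target : Fin (2 ℕ.+ m) → ℚ
      target i = b i - row i · (Q ⊛ b′)
      solution : Σ[ s ∈ ℚ ] Σ[ t ∈ ℚ ]
        (S 0F 0F * s + S 0F 1F * t ≡ target 0F × S 1F 0F * s + S 1F 1F * t ≡ target 1F)
      solution = cramer (S 0F 0F) (S 0F 1F) (S 1F 0F) (S 1F 1F)
        (trivialKernel⇒det≢0 (S 0F 0F) (S 0F 1F) (S 1F 0F) (S 1F 1F) kernel)
        (target 0F) (target 1F)
      s t : ℚ
      s = proj₁ solution
      t = proj₁ (proj₂ solution)
      lem : ∀ p q → p - q + q ≡ p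
      lem = solve-∀ ring
      solves : ∀ i → S i 0F * s + S i 1F * t ≡ target i → (N ⊛ extend b′ s t) i ≡ b i
      solves i eq = begin
        (N ⊛ extend b′ s t) i ≡⟨ eliminate (extend b′ s t) b′ (λ _ → refl) i ⟩
        (S i 0F * s + S i 1F * t) + row i · (Q ⊛ b′)
          ≡⟨ cong (λ p → p + row i · (Q ⊛ b′)) eq ⟩
        target i + row i · (Q ⊛ b′) ≡⟨ lem (b i) (row i · (Q ⊛ b′)) ⟩
        b i ∎
      Nz≡b : ∀ i → (N ⊛ extend b′ s t) i ≡ b i
      Nz≡b 0F            = solves 0F (proj₁ (proj₂ (proj₂ solution)))
      Nz≡b 1F            = solves 1F (proj₂ (proj₂ (proj₂ solution)))
      Nz≡b (suc (suc a)) = extend-solves b′ s t a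

  -- `y₀` and `y₁` are the first two columns of the inverse of `N`. Their right-hand sides vanish on
  -- the trailing rows, so elimination leaves the Schur complement times a two-by-two block equal to
  -- the identity.
  inverse-diagonal⇔ : Q ⊗ trailing ≐ 𝕀 → (y₀ y₁ : Vector ℚ (2 ℕ.+ m)) →
    (∀ i → (N ⊛ y₀) i ≡ 𝕀 0F i) → (∀ i → (N ⊛ y₁) i ≡ 𝕀 1F i) →
    y₀ 0F ≡ y₁ 1F ⇔ S 0F 0F ≡ S 1F 1F
  inverse-diagonal⇔ Q⊗P≐𝕀 y₀ y₁ Ny₀ Ny₁ =
    inverse-diagonal (S 0F 0F) (S 0F 1F) (S 1F 0F) (S 1F 1F)
      (y₀ 0F) (y₁ 0F) (y₀ 1F) (y₁ 1F)
      (reduced y₀ 0F Ny₀ (λ _ → refl) 0F) (reduced y₀ 0F Ny₀ (λ _ → refl) 1F)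
      (reduced y₁ 1F Ny₁ (λ _ → refl) 0F) (reduced y₁ 1F Ny₁ (λ _ → refl) 1F)
    where
    reduced : ∀ y j → (∀ i → (N ⊛ y) i ≡ 𝕀 j i) → (∀ a → 𝕀 j (suc (suc a)) ≡ 0ℚ) →
      ∀ i → S i 0F * y 0F + S i 1F * y 1F ≡ 𝕀 j i
    reduced y j Ny 𝕀≡0 i = trans
      (sym (eliminate₀ y (back-substitute Q⊗P≐𝕀 y (λ _ → 0ℚ)
        (λ a → trans (Ny (suc (suc a))) (𝕀≡0 a))) i))
      (Ny i)

-- Reindexing

𝕀-permute : (π : Permutation k n) → ∀ a b → 𝕀 (π ⟨$⟩ʳ a) (π ⟨$⟩ʳ b) ≡ 𝕀 a b
𝕀-permute π a b with a ≟ b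
... | yes refl = 𝕀-diag (π ⟨$⟩ʳ a)
... | no a≢b   = 𝕀-off-diag λ πa≡πb → a≢b
  (trans (sym (inverseˡ π)) (trans (cong (π ⟨$⟩ˡ_) πa≡πb) (inverseˡ π)))

module Reindex (A : Matrix n n) (π : Permutation k n) where

  reindexed : Matrix k k
  reindexed a b = A (π ⟨$⟩ʳ a) (π ⟨$⟩ʳ b)

  reindexed-⊛ : ∀ z a → (reindexed ⊛ (λ b → z (π ⟨$⟩ʳ b))) a ≡ (A ⊛ z) (π ⟨$⟩ʳ a)
  reindexed-⊛ z a = sym (sum-permute (λ q → A (π ⟨$⟩ʳ a) q * z q) π)

  ⊛-reindexed : ∀ z p → (A ⊛ (λ q → z (π ⟨$⟩ˡ q))) p ≡ (reindexed ⊛ z) (π ⟨$⟩ˡ p)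
  ⊛-reindexed z p = begin
    (A ⊛ z′) p                     ≡⟨ cong (A ⊛ z′) (inverseʳ π) ⟨
    (A ⊛ z′) (π ⟨$⟩ʳ (π ⟨$⟩ˡ p))     ≡⟨ reindexed-⊛ z′ (π ⟨$⟩ˡ p) ⟨
    (reindexed ⊛ (λ b → z′ (π ⟨$⟩ʳ b))) (π ⟨$⟩ˡ p)
      ≡⟨ ⊛-cong reindexed (λ b → cong z (inverseˡ π)) (π ⟨$⟩ˡ p) ⟩
    (reindexed ⊛ z) (π ⟨$⟩ˡ p)      ∎
    where
    z′ : Vector ℚ n
    z′ q = z (π ⟨$⟩ˡ q)

  reindexed-injective : Injective A → Injective reindexed
  reindexed-injective injective z Bz≡0 a = trans
    (cong z (sym (inverseˡ π)))
    (injective (λ q → z (π ⟨$⟩ˡ q)) (λ p → trans (⊛-reindexed z p) (Bz≡0 (π ⟨$⟩ˡ p)))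
      (π ⟨$⟩ʳ a))

  reindexed-solvable : ((b : Vector ℚ k) → Σ[ z ∈ Vector ℚ k ] (∀ a → (reindexed ⊛ z) a ≡ b a)) →
    (b : Vector ℚ n) → Σ[ z ∈ Vector ℚ n ] (∀ p → (A ⊛ z) p ≡ b p)
  reindexed-solvable solve b with z , Bz≡b ← solve (λ a → b (π ⟨$⟩ʳ a)) =
    (λ q → z (π ⟨$⟩ˡ q)) ,
    λ p → trans (⊛-reindexed z p) (trans (Bz≡b (π ⟨$⟩ˡ p)) (cong b (inverseʳ π)))

-- The Laplacian

-- This rewrites the total Dirichlet energy as twice the sum of `φ p * outflow φ p`.
∑∑-symmetrize : (f : Matrix n n) →
  ∑[ p < n ] ∑[ q < n ] (f p q + f q p) ≡
  ∑[ p < n ] ∑[ q < n ] f p q + ∑[ p < n ] ∑[ q < n ] f p q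
∑∑-symmetrize {n} f = begin
  ∑[ p < n ] ∑[ q < n ] (f p q + f q p)
    ≡⟨ sum-cong-≗ (λ p → ∑-distrib-+ (f p) (λ q → f q p)) ⟩
  ∑[ p < n ] (∑[ q < n ] f p q + ∑[ q < n ] f q p)
    ≡⟨ ∑-distrib-+ (λ p → sum (f p)) (λ p → ∑[ q < n ] f q p) ⟩
  ∑[ p < n ] ∑[ q < n ] f p q + ∑[ p < n ] ∑[ q < n ] f q p
    ≡⟨ cong (λ s → ∑[ p < n ] ∑[ q < n ] f p q + s) (∑-comm f) ⟨
  ∑[ p < n ] ∑[ q < n ] f p q + ∑[ p < n ] ∑[ q < n ] f p q ∎

module _ (G : Graph n) where

  open Graph G using (_~_; _~?_; irrefl) renaming (sym to ~-sym)

  private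
    A : Matrix n n
    A = adjacency G

  A-sym : ∀ p q → A p q ≡ A q p
  A-sym p q = cong (if_then 1ℚ else 0ℚ)
    (does-⇔ (mk⇔ ~-sym ~-sym) (p ~? q) (q ~? p))

  A≥0 : ∀ p q → 0ℚ ≤ A p q
  A≥0 p q with does (p ~? q)
  ... | true  = ℚ.nonNegative⁻¹ 1ℚ
  ... | false = ℚ.≤-refl

  laplacian-diag : ∀ p → laplacian G p p ≡ d G p
  laplacian-diag p = trans
    (cong₂ _-_ (cong (if_then d G p else 0ℚ) (dec-true (p ≟ p) refl))
               (cong (if_then 1ℚ else 0ℚ) (dec-false (p ~? p) (irrefl refl))))
    (ℚ.+-identityʳ (d G p))

  laplacian-sym : ∀ p q → laplacian G p q ≡ laplacian G q p
  laplacian-sym p q = cong₂ _-_ degreeMatrix-sym (A-sym p q)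
    where
    degreeMatrix-sym : degreeMatrix G p q ≡ degreeMatrix G q p
    degreeMatrix-sym with p ≟ q
    ... | yes refl = cong (if_then d G p else 0ℚ) (sym (dec-true (p ≟ p) refl))
    ... | no p≢q   = cong (if_then d G q else 0ℚ) (sym (dec-false (q ≟ p) (p≢q ∘ sym)))

  -- The left side of `UnitCurrentPotential`, and by `laplacian-⊛` the Laplacian applied to `φ`.
  outflow : Vector ℚ n → Vector ℚ n
  outflow φ p = ∑[ q < n ] (A p q * (φ p - φ q))

  d≡∑A : ∀ p → d G p ≡ sum (A p)
  d≡∑A p = ∑-indicator (p ~?_) id

  laplacian-⊛ : ∀ φ p → (laplacian G ⊛ φ) p ≡ outflow φ p
  laplacian-⊛ φ p = begin
    (laplacian G ⊛ φ) p
      ≡⟨ sum-cong-≗ entry ⟩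
    ∑[ q < n ] (𝕀 p q * (d G p * φ q) - A p q * φ q)
      ≡⟨ ∑-distrib-- (λ q → 𝕀 p q * (d G p * φ q)) (λ q → A p q * φ q) ⟩
    (𝕀 ⊛ (λ q → d G p * φ q)) p - A p · φ
      ≡⟨ cong (_- A p · φ) (𝕀-⊛ (λ q → d G p * φ q) p) ⟩
    d G p * φ p - A p · φ
      ≡⟨ cong (λ s → s * φ p - A p · φ) (d≡∑A p) ⟩
    sum (A p) * φ p - A p · φ
      ≡⟨ cong (_- A p · φ) (*-distribʳ-sum (φ p) (A p)) ⟩
    ∑[ q < n ] (A p q * φ p) - A p · φ
      ≡⟨ ·-distrib-- (A p) (λ _ → φ p) φ ⟨
    outflow φ p ∎
    where
    lem₁ : ∀ k a x → (k - a) * x ≡ 1ℚ * (k * x) - a * x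
    lem₁ = solve-∀ ring
    lem₀ : ∀ k a x → (0ℚ - a) * x ≡ 0ℚ * (k * x) - a * x
    lem₀ = solve-∀ ring
    entry : ∀ q → laplacian G p q * φ q ≡ 𝕀 p q * (d G p * φ q) - A p q * φ q
    entry q with does (p ≟ q)
    ... | true  = lem₁ (d G p) (A p q) (φ q)
    ... | false = lem₀ (d G p) (A p q) (φ q)

  outflow-distrib-- : ∀ φ ψ p → outflow (λ q → φ q - ψ q) p ≡ outflow φ p - outflow ψ p
  outflow-distrib-- φ ψ p = trans
    (sum-cong-≗ (λ q → cong (A p q *_) (lem (φ p) (ψ p) (φ q) (ψ q))))
    (·-distrib-- (A p) (λ q → φ p - φ q) (λ q → ψ p - ψ q))
    where
    lem : ∀ a b c e → a - b - (c - e) ≡ a - c - (b - e)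
    lem = solve-∀ ring

  -- By symmetry of `A`, the currents counted at the two ends of an edge cancel.
  ∑-outflow : ∀ φ → sum (outflow φ) ≡ 0ℚ
  ∑-outflow φ = begin
    sum (outflow φ)
      ≡⟨ sum-cong-≗ (λ p → ·-distrib-- (A p) (λ _ → φ p) φ) ⟩
    ∑[ p < n ] (∑[ q < n ] (A p q * φ p) - ∑[ q < n ] (A p q * φ q))
      ≡⟨ ∑-distrib-- (λ p → ∑[ q < n ] (A p q * φ p)) (λ p → ∑[ q < n ] (A p q * φ q)) ⟩
    ∑[ p < n ] ∑[ q < n ] (A p q * φ p) - ∑[ p < n ] ∑[ q < n ] (A p q * φ q)
      ≡⟨ cong (λ s → s - ∑[ p < n ] ∑[ q < n ] (A p q * φ q)) swap ⟩
    ∑[ p < n ] ∑[ q < n ] (A p q * φ q) - ∑[ p < n ] ∑[ q < n ] (A p q * φ q)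
      ≡⟨ ℚ.+-inverseʳ (∑[ p < n ] ∑[ q < n ] (A p q * φ q)) ⟩
    0ℚ ∎
    where
    swap : ∑[ p < n ] ∑[ q < n ] (A p q * φ p) ≡ ∑[ p < n ] ∑[ q < n ] (A p q * φ q)
    swap = trans (∑-comm (λ p q → A p q * φ p))
      (sum-cong-≗ (λ q → sum-cong-≗ (λ p → cong (_* φ p) (A-sym p q))))

  -- Dirichlet energy and harmonic potentials

  module _ (connected : Connected G) (φ : Vector ℚ n) (balanced : ∀ p → outflow φ p ≡ 0ℚ) where

    private
      energy : Matrix n n
      energy p q = A p q * ((φ p - φ q) * (φ p - φ q))

      energy≥0 : ∀ p q → 0ℚ ≤ energy p q
      energy≥0 p q = ℚ.nonNegative⁻¹ (energy p q)
        {{ℚ.nonNeg*nonNeg⇒nonNeg (A p q) ((φ p - φ q) * (φ p - φ q))}}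
        where
        instance
          _ = ℚ.nonNegative (A≥0 p q)
          _ = ℚ.nonNegative (p*p≥0 (φ p - φ q))

      -- Half of a splitting: `energy p q` is `half p q + half q p`, while summing `half p q` over
      -- `q` gives `φ p * outflow φ p`, which is zero.
      half : Matrix n n
      half p q = φ p * (A p q * (φ p - φ q))

      ∑half≡0 : ∑[ p < n ] sum (half p) ≡ 0ℚ
      ∑half≡0 = ∑-zero λ p → begin
        sum (half p)      ≡⟨ *-distribˡ-sum (φ p) (λ q → A p q * (φ p - φ q)) ⟨
        φ p * outflow φ p ≡⟨ cong (φ p *_) (balanced p) ⟩
        φ p * 0ℚ          ≡⟨ ℚ.*-zeroʳ (φ p) ⟩
        0ℚ                ∎

      ∑energy≡0 : ∑[ p < n ] sum (energy p) ≡ 0ℚ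
      ∑energy≡0 = begin
        ∑[ p < n ] sum (energy p)
          ≡⟨ sum-cong-≗ (λ p → sum-cong-≗ (λ q → split p q)) ⟩
        ∑[ p < n ] ∑[ q < n ] (half p q + half q p)
          ≡⟨ ∑∑-symmetrize half ⟩
        ∑[ p < n ] sum (half p) + ∑[ p < n ] sum (half p)
          ≡⟨ cong₂ _+_ ∑half≡0 ∑half≡0 ⟩
        0ℚ ∎
        where
        lem : ∀ a x y → a * ((x - y) * (x - y)) ≡ x * (a * (x - y)) + y * (a * (y - x))
        lem = solve-∀ ring
        split : ∀ p q → energy p q ≡ half p q + half q p
        split p q = trans (lem (A p q) (φ p) (φ q))
          (cong (λ a → half p q + φ q * (a * (φ q - φ p))) (A-sym p q))

      -- Nonnegative terms with total zero vanish one by one, and on an edge the weight of the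
      -- squared difference is 1.
      adjacent⇒≡ : ∀ {p q} → p ~ q → φ p ≡ φ q
      adjacent⇒≡ {p} {q} p~q = x-y≡0⇒x≡y (φ p) (φ q) (p*p≡0⇒p≡0 (φ p - φ q) (begin
        δ²           ≡⟨ ℚ.*-identityˡ δ² ⟨
        1ℚ * δ²      ≡⟨ cong (λ b → (if b then 1ℚ else 0ℚ) * δ²) (dec-true (p ~? q) p~q) ⟨
        energy p q   ≡⟨ ∑≡0⇒≡0 (energy≥0 p)
                          (∑≡0⇒≡0 (λ p → ∑-nonneg (energy≥0 p)) ∑energy≡0 p) q ⟩
        0ℚ           ∎))
        where
        δ² : ℚ
        δ² = (φ p - φ q) * (φ p - φ q)

    harmonic⇒constant : ∀ p q → φ p ≡ φ q
    harmonic⇒constant p q = fold (λ p q → φ p ≡ φ q) (λ p~q φ≡ → trans (adjacent⇒≡ p~q) φ≡) refl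
      (connected p q)

  -- The shifted Laplacian

  module _ .{{_ : NonZero n}} where

    private
      M : Matrix n n
      M = shiftedLaplacian G
      n⁻¹ : ℚ
      n⁻¹ = pos 1 / n

    M-diag : ∀ p → M p p ≡ d G p + n⁻¹
    M-diag p = cong₂ _+_ (laplacian-diag p) (ℚ.*-identityʳ n⁻¹)

    M-sym : ∀ p q → M p q ≡ M q p
    M-sym p q = cong (_+ n⁻¹ * 1ℚ) (laplacian-sym p q)

    M-⊛ : ∀ z p → (M ⊛ z) p ≡ outflow z p + n⁻¹ * sum z
    M-⊛ z p = begin
      (M ⊛ z) p
        ≡⟨ sum-cong-≗ (λ q → lem (laplacian G p q) n⁻¹ (z q)) ⟩
      ∑[ q < n ] (laplacian G p q * z q + n⁻¹ * z q)
        ≡⟨ ∑-distrib-+ (λ q → laplacian G p q * z q) (λ q → n⁻¹ * z q) ⟩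
      (laplacian G ⊛ z) p + ∑[ q < n ] (n⁻¹ * z q)
        ≡⟨ cong₂ _+_ (laplacian-⊛ z p) (sym (*-distribˡ-sum n⁻¹ z)) ⟩
      outflow z p + n⁻¹ * sum z ∎
      where
      lem : ∀ l c x → (l + c * 1ℚ) * x ≡ l * x + c * x
      lem = solve-∀ ring

    n*[n⁻¹*x]≡x : ∀ x → (pos n / 1) * (n⁻¹ * x) ≡ x
    n*[n⁻¹*x]≡x x = begin
      (pos n / 1) * (n⁻¹ * x) ≡⟨ ℚ.*-assoc (pos n / 1) n⁻¹ x ⟨
      (pos n / 1) * n⁻¹ * x   ≡⟨ cong (_* x) (n/1*1/n n) ⟩
      1ℚ * x                  ≡⟨ ℚ.*-identityˡ x ⟩
      x                       ∎

    n*-cancel : ∀ {x y} → (pos n / 1) * x ≡ (pos n / 1) * y → x ≡ y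
    n*-cancel = *-cancelˡ-invertible n⁻¹ (pos n / 1)
      (trans (ℚ.*-comm n⁻¹ (pos n / 1)) (n/1*1/n n))

    -- The outflows cancel in total, and the averaging part adds `n⁻¹ * sum z` once per vertex.
    ∑-M-⊛ : ∀ z → sum (M ⊛ z) ≡ sum z
    ∑-M-⊛ z = begin
      sum (M ⊛ z)
        ≡⟨ sum-cong-≗ (M-⊛ z) ⟩
      ∑[ p < n ] (outflow z p + n⁻¹ * sum z)
        ≡⟨ ∑-distrib-+ (outflow z) (λ _ → n⁻¹ * sum z) ⟩
      sum (outflow z) + ∑[ p < n ] (n⁻¹ * sum z)
        ≡⟨ cong₂ _+_ (∑-outflow z) (∑-const n (n⁻¹ * sum z)) ⟩
      0ℚ + (pos n / 1) * (n⁻¹ * sum z)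
        ≡⟨ ℚ.+-identityˡ ((pos n / 1) * (n⁻¹ * sum z)) ⟩
      (pos n / 1) * (n⁻¹ * sum z)
        ≡⟨ n*[n⁻¹*x]≡x (sum z) ⟩
      sum z ∎

    M-⊛-1 : ∀ p → (M ⊛ (λ _ → 1ℚ)) p ≡ 1ℚ
    M-⊛-1 p = begin
      (M ⊛ (λ _ → 1ℚ)) p
        ≡⟨ M-⊛ (λ _ → 1ℚ) p ⟩
      outflow (λ _ → 1ℚ) p + n⁻¹ * ∑[ q < n ] 1ℚ
        ≡⟨ cong₂ _+_ (∑-zero (λ q → ℚ.*-zeroʳ (A p q))) (cong (n⁻¹ *_) (∑-const n 1ℚ)) ⟩
      0ℚ + n⁻¹ * ((pos n / 1) * 1ℚ)
        ≡⟨ lem n⁻¹ (pos n / 1) ⟩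
      (pos n / 1) * (n⁻¹ * 1ℚ)
        ≡⟨ n*[n⁻¹*x]≡x 1ℚ ⟩
      1ℚ ∎
      where
      lem : ∀ a b → 0ℚ + a * (b * 1ℚ) ≡ b * (a * 1ℚ)
      lem = solve-∀ ring

    ∑≡0⇒outflow≡M : ∀ z → sum z ≡ 0ℚ → ∀ p → outflow z p ≡ (M ⊛ z) p
    ∑≡0⇒outflow≡M z ∑z≡0 p = sym (begin
      (M ⊛ z) p                   ≡⟨ M-⊛ z p ⟩
      outflow z p + n⁻¹ * sum z   ≡⟨ cong (λ s → outflow z p + n⁻¹ * s) ∑z≡0 ⟩
      outflow z p + n⁻¹ * 0ℚ      ≡⟨ cong (λ s → outflow z p + s) (ℚ.*-zeroʳ n⁻¹) ⟩
      outflow z p + 0ℚ            ≡⟨ ℚ.+-identityʳ (outflow z p) ⟩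
      outflow z p                 ∎)

    module _ (connected : Connected G) where

      M-injective : Injective M
      -- A constant `z` with total zero is zero, because `n` times each entry is the total.
      M-injective z Mz≡0 i = n*-cancel (begin
        (pos n / 1) * z i ≡⟨ ∑-const n (z i) ⟨
        ∑[ p < n ] z i    ≡⟨ sum-cong-≗ (λ p → harmonic⇒constant connected z balanced i p) ⟩
        sum z             ≡⟨ ∑z≡0 ⟩
        0ℚ                ≡⟨ ℚ.*-zeroʳ (pos n / 1) ⟨
        (pos n / 1) * 0ℚ  ∎)
        where
        ∑z≡0 : sum z ≡ 0ℚ
        ∑z≡0 = trans (sym (∑-M-⊛ z)) (∑-zero Mz≡0)
        balanced : ∀ p → outflow z p ≡ 0ℚ
        balanced p = trans (∑≡0⇒outflow≡M z ∑z≡0 p) (Mz≡0 p)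

      -- The difference of the two potentials has no outflow anywhere, so it is constant.
      potentialDifference-unique : ∀ φ ψ → (∀ p → outflow φ p ≡ outflow ψ p) →
        ∀ i j → φ i - φ j ≡ ψ i - ψ j
      potentialDifference-unique φ ψ φ≡ψ i j = begin
        φ i - φ j                         ≡⟨ lem (φ i) (ψ i) (φ j) ⟩
        (φ i - ψ i) + (ψ i - φ j)         ≡⟨ cong (_+ (ψ i - φ j)) 
                                               (harmonic⇒constant connected (λ q → φ q - ψ q) balanced i j) ⟩
        (φ j - ψ j) + (ψ i - φ j)         ≡⟨ lem′ (φ j) (ψ j) (ψ i) ⟩
        ψ i - ψ j                         ∎
        where
        lem : ∀ a b c → a - c ≡ (a - b) + (b - c)
        lem = solve-∀ ring
        lem′ : ∀ a b c → (a - b) + (c - a) ≡ c - b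
        lem′ = solve-∀ ring
        balanced : ∀ p → outflow (λ q → φ q - ψ q) p ≡ 0ℚ
        balanced p = begin
          outflow (λ q → φ q - ψ q) p  ≡⟨ outflow-distrib-- φ ψ p ⟩
          outflow φ p - outflow ψ p    ≡⟨ cong (_- outflow ψ p) (φ≡ψ p) ⟩
          outflow ψ p - outflow ψ p    ≡⟨ ℚ.+-inverseʳ (outflow ψ p) ⟩
          0ℚ                           ∎

      -- The Green matrix and the row sums of the resistance matrix

      module Green (g : Matrix n n) (Mg : ∀ j p → (M ⊛ g j) p ≡ 𝕀 j p) where

        -- `M` preserves the total of a vector, and `M ⊛ g j` is a unit vector.
        ∑g-row : ∀ j → sum (g j) ≡ 1ℚ
        ∑g-row j = trans (sym (∑-M-⊛ (g j))) (trans (sum-cong-≗ (Mg j)) (∑-𝕀 j))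

        -- The sum `γ` of all `g j` and the constant vector 1 have the same image under `M`, so
        -- injectivity identifies them.
        ∑g-column : ∀ p → ∑[ j < n ] g j p ≡ 1ℚ
        ∑g-column p = x-y≡0⇒x≡y (γ p) 1ℚ (M-injective (λ q → γ q - 1ℚ) (λ i → begin
          (M ⊛ (λ q → γ q - 1ℚ)) i             ≡⟨ ·-distrib-- (M i) γ (λ _ → 1ℚ) ⟩
          (M ⊛ γ) i - (M ⊛ (λ _ → 1ℚ)) i        ≡⟨ cong₂ _-_ (Mγ i) (M-⊛-1 i) ⟩
          1ℚ - 1ℚ                              ≡⟨⟩
          0ℚ                                   ∎) p)
          where
          γ : Vector ℚ n
          γ q = ∑[ j < n ] g j q
          Mγ : ∀ i → (M ⊛ γ) i ≡ 1ℚ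
          Mγ i = begin
            (M ⊛ γ) i
              ≡⟨ sum-cong-≗ (λ q → *-distribˡ-sum (M i q) (λ j → g j q)) ⟩
            ∑[ q < n ] ∑[ j < n ] (M i q * g j q)
              ≡⟨ ∑-comm (λ q j → M i q * g j q) ⟩
            ∑[ j < n ] (M ⊛ g j) i
              ≡⟨ sum-cong-≗ (λ j → trans (Mg j i) (𝕀-sym j i)) ⟩
            sum (𝕀 i)
              ≡⟨ ∑-𝕀 i ⟩
            1ℚ ∎

        φ : Fin n → Fin n → Vector ℚ n
        φ i j p = g i p - g j p

        φ-potential : ∀ i j → UnitCurrentPotential G i j (φ i j)
        φ-potential i j p = begin
          -- Both `g i` and `g j` have total 1, so the averaging part of `M` vanishes on their
          -- difference.
          outflow (φ i j) p          ≡⟨ ∑≡0⇒outflow≡M (φ i j) ∑φ≡0 p ⟩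
          (M ⊛ φ i j) p              ≡⟨ ·-distrib-- (M p) (g i) (g j) ⟩
          (M ⊛ g i) p - (M ⊛ g j) p  ≡⟨ cong₂ _-_ (Mg i p) (Mg j p) ⟩
          𝕀 i p - 𝕀 j p              ∎
          where
          ∑φ≡0 : sum (φ i j) ≡ 0ℚ
          ∑φ≡0 = trans (∑-distrib-- (g i) (g j)) (cong₂ _-_ (∑g-row i) (∑g-row j))

        -- Unfolds to `g i i - g j i - (g i j - g j j)`, the resistance formula with `g` in place of
        -- the Moore-Penrose inverse.
        R : Matrix n n
        R i j = φ i j i - φ i j j

        R-isResistanceMatrix : IsResistanceMatrix G R
        R-isResistanceMatrix i j = φ i j , φ-potential i j , refl

        -- This lets the matrix hidden in `ResistanceRegular` be replaced by `R`.
        R-unique : ∀ {R′} → IsResistanceMatrix G R′ → ∀ i j → R′ i j ≡ R i j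
        R-unique isR′ i j with ψ , ψ-potential , R′≡ ← isR′ i j = trans R′≡
          (potentialDifference-unique ψ (φ i j)
            (λ p → trans (ψ-potential p) (sym (φ-potential i j p))) i j)

        -- Row and column sums of `g` are 1, so only the term in `g i i` depends on `i`.
        ∑R : ∀ i → sum (R i) ≡ (pos n / 1) * g i i + (∑[ j < n ] g j j - (1ℚ + 1ℚ))
        ∑R i = begin
          sum (R i)
            ≡⟨ ∑-distrib-- (λ j → g i i - g j i) (λ j → g i j - g j j) ⟩
          ∑[ j < n ] (g i i - g j i) - ∑[ j < n ] (g i j - g j j)
            ≡⟨ cong₂ _-_ (∑-distrib-- (λ _ → g i i) (λ j → g j i))
                         (∑-distrib-- (g i) (λ j → g j j)) ⟩
          (∑[ j < n ] g i i - ∑[ j < n ] g j i) - (sum (g i) - tr)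
            ≡⟨ cong₂ _-_ (cong₂ _-_ (∑-const n (g i i)) (∑g-column i))
                         (cong (_- tr) (∑g-row i)) ⟩
          ((pos n / 1) * g i i - 1ℚ) - (1ℚ - tr)
            ≡⟨ lem ((pos n / 1) * g i i) 1ℚ tr ⟩
          (pos n / 1) * g i i + (tr - (1ℚ + 1ℚ)) ∎
          where
          tr : ℚ
          tr = ∑[ j < n ] g j j
          lem : ∀ x c t → (x - c) - (c - t) ≡ x + (t - (c + c))
          lem = solve-∀ ring

        regular⇔diagonal-constant : ResistanceRegular G ⇔ (∀ i j → g i i ≡ g j j)
        regular⇔diagonal-constant = mk⇔
          (λ (R′ , isR′ , ∑R′≡) i j → n*-cancel
            (∙-cancelʳ c ((pos n / 1) * g i i) ((pos n / 1) * g j j) (begin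
              (pos n / 1) * g i i + c ≡⟨ ∑R i ⟨
              sum (R i)   ≡⟨ sum-cong-≗ (R-unique isR′ i) ⟨
              sum (R′ i)  ≡⟨ ∑R′≡ i j ⟩
              sum (R′ j)  ≡⟨ sum-cong-≗ (R-unique isR′ j) ⟩
              sum (R j)   ≡⟨ ∑R j ⟩
              (pos n / 1) * g j j + c ∎)))
          (λ g≡ → R , R-isResistanceMatrix , λ i j → begin
            sum (R i) ≡⟨ ∑R i ⟩
            (pos n / 1) * g i i + c ≡⟨ cong (λ x → (pos n / 1) * x + c) (g≡ i j) ⟩
            (pos n / 1) * g j j + c ≡⟨ ∑R j ⟨
            sum (R j) ∎)
          where
          c : ℚ
          c = ∑[ j < n ] g j j - (1ℚ + 1ℚ)

        -- Diagonal entries of the Green matrix through the block form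

        module _ {u v : Fin n} (o : OrderingFrom u v)
                 (P-invertible : Invertible (Blocks.P G o)) where

          open Blocks G o
          open OrderingFrom o
          open Invertible P-invertible using () renaming (inverse to Q; inverseˡ to Q-inverseˡ)
          open Schur reordered Q using (S; row; inverse-diagonal⇔)
          open Reindex M perm using (reindexed-⊛)

          private
            -- `Blocks` reads `x` and `y` off columns whereas `S` uses rows; symmetry of `M`
            -- reconciles them.
            row-0F : ∀ b → row 0F b ≡ x b
            row-0F b = M-sym (perm ⟨$⟩ʳ 0F) (perm ⟨$⟩ʳ suc (suc b))
            row-1F : ∀ b → row 1F b ≡ y b
            row-1F b = M-sym (perm ⟨$⟩ʳ 1F) (perm ⟨$⟩ʳ suc (suc b))

            S-00 : S 0F 0F ≡ d G u + n⁻¹ - x · (Q ⊛ x)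
            S-00 = cong₂ _-_ (trans (cong (λ p → M p p) first) (M-diag u))
              (·-cong row-0F (λ _ → refl))

            S-11 : S 1F 1F ≡ d G v + n⁻¹ - y · (Q ⊛ y)
            S-11 = cong₂ _-_ (trans (cong (λ p → M p p) second) (M-diag v))
              (·-cong row-1F (λ _ → refl))

            -- Keeping `w` a variable allows matching on `refl`, so that `first` and `second` can
            -- both be supplied.
            column : ∀ {w} a → perm ⟨$⟩ʳ a ≡ w →
              ∀ b → (reordered ⊛ (λ c → g w (perm ⟨$⟩ʳ c))) b ≡ 𝕀 a b
            column a refl b = trans (reindexed-⊛ (g (perm ⟨$⟩ʳ a)) b)
              (trans (Mg (perm ⟨$⟩ʳ a) (perm ⟨$⟩ʳ b)) (𝕀-permute perm a b))

            -- The two diagonal entries share the summand `n⁻¹`, which cancels.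
            S-equal⇔ : S 0F 0F ≡ S 1F 1F ⇔ d G v - d G u ≡ y · (Q ⊛ y) - x · (Q ⊛ x)
            S-equal⇔ = mk⇔
              (λ S≡ → begin
                d G v - d G u ≡⟨ lem₁ (d G u) (d G v) n⁻¹ X Y ⟩
                (d G v + n⁻¹ - Y) - (d G u + n⁻¹ - X) + (Y - X)
                  ≡⟨ cong₂ (λ a b → a - b + (Y - X)) S-11 S-00 ⟨
                S 1F 1F - S 0F 0F + (Y - X)
                  ≡⟨ cong (λ a → S 1F 1F - a + (Y - X)) S≡ ⟩
                S 1F 1F - S 1F 1F + (Y - X)
                  ≡⟨ cong (_+ (Y - X)) (ℚ.+-inverseʳ (S 1F 1F)) ⟩
                0ℚ + (Y - X) ≡⟨ ℚ.+-identityˡ (Y - X) ⟩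
                Y - X ∎)
              (λ d≡ → begin
                S 0F 0F ≡⟨ S-00 ⟩
                d G u + n⁻¹ - X ≡⟨ lem₂ (d G u) n⁻¹ X Y ⟩
                d G u + n⁻¹ + (Y - X) - Y ≡⟨ cong (λ a → d G u + n⁻¹ + a - Y) d≡ ⟨
                d G u + n⁻¹ + (d G v - d G u) - Y ≡⟨ lem₃ (d G u) (d G v) n⁻¹ Y ⟩
                d G v + n⁻¹ - Y ≡⟨ S-11 ⟨
                S 1F 1F ∎)
              where
              X Y : ℚ
              X = x · (Q ⊛ x)
              Y = y · (Q ⊛ y)
              lem₁ : ∀ a b c x y → b - a ≡ (b + c - y) - (a + c - x) + (y - x)
              lem₁ = solve-∀ ring
              lem₂ : ∀ a c x y → a + c - x ≡ a + c + (y - x) - y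
              lem₂ = solve-∀ ring
              lem₃ : ∀ a b c y → a + c + (b - a) - y ≡ b + c - y
              lem₃ = solve-∀ ring

          diagonal-equal⇔ : g u u ≡ g v v ⇔ d G v - d G u ≡ y · (Q ⊛ y) - x · (Q ⊛ x)
          -- `inverse-diagonal⇔` speaks of the images of `0F` and `1F` under `perm`; the
          -- substitution moves them to `u` and `v`.
          diagonal-equal⇔ = S-equal⇔ ⇔-∘ subst₂ (λ p q → p ≡ q ⇔ S 0F 0F ≡ S 1F 1F)
            (cong (g u) first) (cong (g v) second)
            (inverse-diagonal⇔ Q-inverseˡ
              (λ c → g u (perm ⟨$⟩ʳ c)) (λ c → g v (perm ⟨$⟩ʳ c))
              (column 0F first) (column 1F second))

      M-solvable : {u v : Fin n} (o : OrderingFrom u v) → Invertible (Blocks.P G o) →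
        (b : Vector ℚ n) → Σ[ z ∈ Vector ℚ n ] (∀ p → (M ⊛ z) p ≡ b p)
      M-solvable o P-invertible = reindexed-solvable
        (Schur.solvable reindexed Q Q-inverseʳ (reindexed-injective M-injective))
        where
        open Reindex M (OrderingFrom.perm o)
        open Invertible P-invertible using () renaming (inverse to Q; inverseʳ to Q-inverseʳ)

-- Existence of the Green matrix and the equivalence

greenMatrix : ∀ n .{{_ : NonZero n}} (G : Graph n) → Connected G →
  (ordering : ∀ (u v : Fin n) → u ≢ v → OrderingFrom u v) →
  (∀ u v (u≢v : u ≢ v) → Invertible (Blocks.P G (ordering u v u≢v))) →
  Σ[ g ∈ Matrix n n ] (∀ j p → (shiftedLaplacian G ⊛ g j) p ≡ 𝕀 j p)
-- With one vertex there is no pair `u`, `v` and hence no block `P`; the constant 1 solves the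
-- system by `M-⊛-1`.
greenMatrix 1 G connected ordering P-invertible =
  (λ _ _ → 1ℚ) , λ { 0F 0F → M-⊛-1 G 0F }
greenMatrix (suc (suc m)) G connected ordering P-invertible =
  (λ j → proj₁ (column j)) , (λ j → proj₂ (column j))
  where
  column : ∀ j → Σ[ z ∈ Vector ℚ (suc (suc m)) ] (∀ p → (shiftedLaplacian G ⊛ z) p ≡ 𝕀 j p)
  -- A single pair of distinct vertices serves for every right-hand side `𝕀 j`.
  column j = M-solvable G connected (ordering 0F 1F λ ()) (P-invertible 0F 1F λ ()) (𝕀 j)

theorem2p34 :
    ∀ (n : ℕ) .{{_ : NonZero n}} (G : Graph n) → Connected G →
    (ordering : ∀ (u v : Fin n) → u ≢ v → OrderingFrom u v) →
    (P-invertible : ∀ u v (u≢v : u ≢ v) → Invertible (Blocks.P G (ordering u v u≢v))) →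
    ResistanceRegular G ⇔
      (∀ u v (u≢v : u ≢ v) →
        let open Blocks G (ordering u v u≢v)
            P⁻¹ = inverse (P-invertible u v u≢v)
        in d G v - d G u ≡ y · (P⁻¹ ⊛ y) - x · (P⁻¹ ⊛ x))
theorem2p34 n G connected ordering P-invertible = mk⇔
  (λ regular u v u≢v → Equivalence.to (entries⇔ u v u≢v)
    (Equivalence.to regular⇔diagonal-constant regular u v))
  (λ condition → Equivalence.from regular⇔diagonal-constant
    (constant λ u v u≢v → Equivalence.from (entries⇔ u v u≢v) (condition u v u≢v)))
  where
  green = greenMatrix n G connected ordering P-invertible
  g : Matrix n n
  g = proj₁ green
  open Green G connected g (proj₂ green)
  entries⇔ = λ u v u≢v → diagonal-equal⇔ (ordering u v u≢v) (P-invertible u v u≢v)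
  -- The block condition covers distinct vertices only; the case `u = v` is trivial.
  constant : (∀ u v → u ≢ v → g u u ≡ g v v) → ∀ u v → g u u ≡ g v v
  constant g≡ u v with u ≟ v
  ... | yes refl = refl
  ... | no u≢v   = g≡ u v u≢v
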